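{- Let $B_1$ and $B_2$ be $m$-level rook equivalent singleton boards, both written with $n$ columns, such that $\{B_1,B_2\}$ is an edge of the $m$-level rook equivalence graph. Then the $m$-level root vectors $\xi_m(B_1)$ and $\xi_m(B_2)$ differ only in two positions, whose entries are swapped. That is, if $\xi_m(B_1)=\langle z_1,\ldots,z_{i_1},\ldots,z_{i_2},\ldots,z_n\rangle$ then $\xi_m(B_2)=\langle z_1,\ldots,z_{i_2},\ldots,z_{i_1},\ldots,z_n\rangle$ for some $1\le i_1<i_2\le n$ with $z_{i_1}\ne z_{i_2}$.
   Context: Fix an integer $m>0$. A Ferrers board is given by a weakly increasing sequence of non-negative integers $B=(b_1,\ldots,b_n)$ of column heights (cells in column $i$, rows $1,\ldots,b_i$, of the first quadrant); prepending height-$0$ columns on the left does not change the board, and boards are compared with the same number of columns by such padding. The rows are partitioned into levels: level $t$ consists of rows $(t-1)m+1,\ldots,tm$. An $m$-level rook placement of $k$ rooks is a set of $k$ cells of $B$, no two in the same level or the same column; $r_{k,m}(B)$ is their number, and two boards are $m$-level rook equivalent if they have equal $r_{k,m}$ for all $k\ge0$. For an integer $o$, $\lfloor o\rfloor_m$ is the largest multiple of $m$ that is $\le o$. $B$ is singleton if for each $i<n$, $b_i-\lfloor b_i\rfloor_m\ne0$ implies $\lfloor b_i\rfloor_m<\lfloor b_{i+1}\rfloor_m$. The $m$-level root vector of $B$ is $\xi_m(B)=\langle 0-b_1,m-b_2,\ldots,m(n-1)-b_n\rangle$. The $m$-level rook equivalence graph of the class of a singleton board $B$ has as vertices all singleton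 boards $m$-level rook equivalent to $B$, and $\{B_1,B_2\}$ is an edge iff, written with the same number of columns, $B_1$ and $B_2$ differ in exactly two columns $i,j$, where $B_1$ has $k$ more cells than $B_2$ in column $i$ and $k$ fewer in column $j$, for some $k>0$. -}

module Defs where

open import Data.Nat.Base using (ℕ; suc; _+_; _*_; _∸_; _/_; _≤_; _<_; _>_; NonZero)
import Data.Nat.Properties as ℕ
open import Data.Integer.Base as ℤ using (ℤ; +_)
open import Data.Fin.Base as Fin using (Fin; toℕ)
import Data.Fin.Properties as Fin
open import Data.List.Base using (List; []; _∷_; _++_; map; concatMap; filter; length; upTo; allFin)
open import Data.List.Relation.Unary.AllPairs as AllPairs using (AllPairs; allPairs?)
open import Data.Product.Base using (_×_; _,_; ∃-syntax)
open import Data.Vec.Functional using (Vector)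
open import Relation.Binary.Definitions using (Decidable)
open import Relation.Binary.PropositionalEquality using (_≡_; _≢_)
open import Relation.Nullary.Decidable using (_×-dec_; ¬?)
import Relation.Unary as U

record Board (n : ℕ) : Set where
  field
    height     : Vector ℕ n
    increasing : ∀ {i j} → i Fin.≤ j → height i ≤ height j

open Board public

-- Columns and rows are both numbered from 0, so a column of height h has
-- cells in rows 0, …, h ∸ 1.
Cell : ℕ → Set
Cell n = Fin n × ℕ

cells : ∀ {n} → Board n → List (Cell n)
cells {n} B = concatMap (λ i → map (i ,_) (upTo (height B i))) (allFin n)

-- For a list without repetitions (such as cells B) this enumerates its
-- subsets, each exactly once.
sublists : ∀ {A : Set} → List A → List (List A)
sublists []       = [] ∷ []
sublists (x ∷ xs) = map (x ∷_) (sublists xs) ++ sublists xs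

module _ (m : ℕ) .{{_ : NonZero m}} where

  -- With rows numbered from 0, two rows lie in the same level exactly when
  -- they have the same quotient by m.
  level : ℕ → ℕ
  level row = row / m

  NonAttacking : ∀ {n} → Cell n → Cell n → Set
  NonAttacking (i , r) (j , s) = level r ≢ level s × i ≢ j

  nonAttacking? : ∀ {n} → Decidable (NonAttacking {n})
  nonAttacking? (i , r) (j , s) = ¬? (level r ℕ.≟ level s) ×-dec ¬? (i Fin.≟ j)

  IsPlacement : ∀ {n} → ℕ → List (Cell n) → Set
  IsPlacement k P = length P ≡ k × AllPairs NonAttacking P

  isPlacement? : ∀ {n} k → U.Decidable (IsPlacement {n} k)
  isPlacement? k P = (length P ℕ.≟ k) ×-dec allPairs? nonAttacking? P

  rookNumber : ∀ {n} → ℕ → Board n → ℕ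
  rookNumber k B = length (filter (isPlacement? k) (sublists (cells B)))

  RookEquivalent : ∀ {n n′} → Board n → Board n′ → Set
  RookEquivalent B B′ = ∀ k → rookNumber k B ≡ rookNumber k B′

  ⌊_⌋ : ℕ → ℕ
  ⌊ o ⌋ = (o / m) * m

  Singleton : ∀ {n} → Board n → Set
  Singleton B = ∀ i j → toℕ j ≡ suc (toℕ i) →
    height B i ∸ ⌊ height B i ⌋ ≢ 0 → ⌊ height B i ⌋ < ⌊ height B j ⌋

  -- The factor is m(i - 1) for the i-th column, which has index i - 1 in Fin n.
  rootVector : ∀ {n} → Board n → Vector ℤ n
  rootVector B i = + (m * toℕ i) ℤ.- + height B i

  IsVertex : ∀ {n n′} → Board n → Board n′ → Set
  IsVertex B B′ = Singleton B′ × RookEquivalent B′ B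

  -- Nothing is assumed about the order of i and j, so this is symmetric.
  DifferInTwoColumns : ∀ {n} → Board n → Board n → Set
  DifferInTwoColumns {n} B₁ B₂ =
    ∃[ i ] ∃[ j ] ∃[ k ] k > 0 × i ≢ j
      × height B₁ i ≡ height B₂ i + k
      × height B₂ j ≡ height B₁ j + k
      × (∀ (l : Fin n) → l ≢ i → l ≢ j → height B₁ l ≡ height B₂ l)

  -- Edges of the graph of the class of B. Both ends are written with the same
  -- number of columns; padding them with further columns of height 0 on the
  -- left adds only columns where they agree.
  IsEdge : ∀ {n n′} → Board n → Board n′ → Board n′ → Set
  IsEdge B B₁ B₂ = IsVertex B B₁ × IsVertex B B₂ × DifferInTwoColumns B₁ B₂

{-# OPTIONS --safe #-}
module Submission where

-- The sum of the root vector entries is the same for both boards because only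
-- two columns change, by opposite amounts, so it suffices to compare one
-- quadratic invariant.  In a singleton board every cell of column a shares its
-- level with exactly m cells of each later column, hence
-- r₂ = Σ_{a<b} h_a (h_b - m), which together with Σ h determines
-- Σ_a (h_a² + 2m h_a (n - 1 - a)).  Only columns i and j contribute to the
-- difference of these quantities, which is 2k ((p + m (n-1-i)) - (q + m (n-1-j)))
-- for the smaller heights p = B₂(i) and q = B₁(j).  Its vanishing says that the
-- two root entries are exchanged.

open import Defs
open import Data.Nat.Base using (ℕ; NonZero)
open import Data.Fin.Base using (Fin; _<_)
open import Data.Product.Base using (_×_; ∃-syntax)
open import Relation.Binary.PropositionalEquality using (_≡_; _≢_)

open import Data.Nat.Base as ℕ using (zero; suc; s≤s; _+_; _*_; _∸_; _/_)
import Data.Nat.Properties as ℕ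
import Data.Nat.DivMod as ℕ
open import Data.Nat.Tactic.RingSolver using (solve-∀)
import Data.Integer.Base as ℤ
import Data.Integer.Properties as ℤ
open import Data.Fin.Base as Fin using (zero; suc; toℕ; fromℕ<)
import Data.Fin.Properties as Fin
open import Data.List.Base
  using (List; []; _∷_; _++_; map; concatMap; filter; length; tabulate; applyUpTo; upTo)
open import Data.Nat.ListAction using (sum)
import Data.List.Properties as List
open import Data.List.Relation.Unary.All as All using (All; []; _∷_)
import Data.List.Relation.Unary.All.Properties as All
open import Data.List.Relation.Unary.AllPairs using (AllPairs; []; _∷_; allPairs?)
open import Data.Product.Base using (_,_; proj₁)
open import Data.Vec.Functional using (Vector; removeAt; updateAt)
open import Data.Vec.Functional.Properties using (updateAt-updates; updateAt-minimal)
open import Function.Base using (_∘_; id; const)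
open import Level using (0ℓ)
open import Relation.Binary.Core using (Rel)
import Relation.Binary.Definitions as B
open import Relation.Binary.Definitions using (tri<; tri≈; tri>)
open import Relation.Binary.PropositionalEquality
  using (refl; sym; trans; cong; cong₂; subst; subst₂; ≢-sym; module ≡-Reasoning)
open import Relation.Nullary.Decidable using (Dec; yes; no; _×-dec_)
open import Relation.Nullary.Negation using (contradiction)
import Relation.Unary as U

import Algebra.Properties.AbelianGroup ℤ.+-0-abelianGroup as ℤ-group
open import Algebra.Properties.Semiring.Sum ℕ.+-*-semiring as Σ
  using () renaming (sum to ∑)

open ≡-Reasoning

-- Counting list entries and sublists.

module _ {A : Set} {P : U.Pred A 0ℓ} (P? : U.Decidable P) where

  count : List A → ℕ
  count xs = length (filter P? xs)

  count-++ : ∀ xs ys → count (xs ++ ys) ≡ count xs + count ys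
  count-++ xs ys = trans (cong length (List.filter-++ P? xs ys))
    (List.length-++ (filter P? xs))

  count-all : ∀ {xs} → All P xs → count xs ≡ length xs
  count-all = cong length ∘ List.filter-all P?

  count-none : ∀ {xs} → All (U.∁ P) xs → count xs ≡ 0
  count-none = cong length ∘ List.filter-none P?

  count-map : ∀ {B : Set} (f : B → A) xs →
    count (map f xs) ≡ length (filter (P? ∘ f) xs)
  count-map f [] = refl
  count-map f (x ∷ xs) with P? (f x)
  ... | yes _ = cong suc (count-map f xs)
  ... | no  _ = count-map f xs

count-≐ : ∀ {A : Set} {P Q : U.Pred A 0ℓ} (P? : U.Decidable P) (Q? : U.Decidable Q) →
  P U.≐ Q → ∀ xs → count P? xs ≡ count Q? xs
count-≐ P? Q? P≐Q xs = cong length (List.filter-≐ P? Q? P≐Q xs)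

count-[] : ∀ {A : Set} (xs : List A) →
  count (λ ys → length ys ℕ.≟ 0) (sublists xs) ≡ 1
count-[] [] = refl
count-[] (x ∷ xs) = begin
  count empty? (map (x ∷_) (sublists xs) ++ sublists xs)
    ≡⟨ count-++ empty? (map (x ∷_) (sublists xs)) _ ⟩
  count empty? (map (x ∷_) (sublists xs)) + count empty? (sublists xs)
    ≡⟨ cong₂ _+_ (count-none empty? (All.map⁺ (All.universal (λ _ ()) (sublists xs)))) (count-[] xs) ⟩
  1 ∎
  where
  empty? : U.Decidable {A = List _} (λ ys → length ys ≡ 0)
  empty? ys = length ys ℕ.≟ 0

-- Two-rook placements as pairs of list entries.

module _ {A : Set} {R : Rel A 0ℓ} (R? : B.Decidable R) where

  pairs : List A → ℕ
  pairs []       = 0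
  pairs (x ∷ xs) = count (R? x) xs + pairs xs

  crossPairs : List A → List A → ℕ
  crossPairs xs ys = sum (map (λ x → count (R? x) ys) xs)

  pairs-++ : ∀ xs ys → pairs (xs ++ ys) ≡ pairs xs + crossPairs xs ys + pairs ys
  pairs-++ [] ys = refl
  pairs-++ (x ∷ xs) ys = begin
    count (R? x) (xs ++ ys) + pairs (xs ++ ys)
      ≡⟨ cong₂ _+_ (count-++ (R? x) xs ys) (pairs-++ xs ys) ⟩
    (count (R? x) xs + count (R? x) ys) + (pairs xs + crossPairs xs ys + pairs ys)
      ≡⟨ rearrange (count (R? x) xs) (count (R? x) ys) (pairs xs) (crossPairs xs ys) (pairs ys) ⟩
    (count (R? x) xs + pairs xs) + (count (R? x) ys + crossPairs xs ys) + pairs ys ∎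
    where
    rearrange : ∀ a b c d e → (a + b) + (c + d + e) ≡ (a + c) + (b + d) + e
    rearrange = solve-∀

  -- At `nonAttacking? m` this unfolds to `isPlacement? m`, so its count over `sublists (cells B)`
  -- is `rookNumber` by definition.
  placement? : ∀ k → U.Decidable (λ xs → length xs ≡ k × AllPairs R xs)
  placement? k xs = (length xs ℕ.≟ k) ×-dec allPairs? R? xs

  -- Once `x` is chosen, a two-element placement is completed by a single later entry related to
  -- `x`. The induction splits the sublists by whether they contain the head of the list.
  count-2-placements-∷ : ∀ x xs →
    count (placement? 2 ∘ (x ∷_)) (sublists xs) ≡ count (R? x) xs
  count-2-placements-∷ x [] = refl
  count-2-placements-∷ x (y ∷ xs) = begin
    count Q? (map (y ∷_) (sublists xs) ++ sublists xs)
      ≡⟨ count-++ Q? (map (y ∷_) (sublists xs)) _ ⟩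
    count Q? (map (y ∷_) (sublists xs)) + count Q? (sublists xs)
      ≡⟨ cong₂ _+_ (count-map Q? (y ∷_) (sublists xs)) (count-2-placements-∷ x xs) ⟩
    count (Q? ∘ (y ∷_)) (sublists xs) + count (R? x) xs
      ≡⟨ containing-y (R? x y) ⟩
    count (R? x) (y ∷ xs) ∎
    where
    Q? = placement? 2 ∘ (x ∷_)
    containing-y : Dec (R x y) →
      count (Q? ∘ (y ∷_)) (sublists xs) + count (R? x) xs ≡ count (R? x) (y ∷ xs)
    containing-y (no ¬Rxy) = trans
      (cong (_+ count (R? x) xs) (count-none (Q? ∘ (y ∷_))
        (All.universal (λ { _ (_ , (Rxy ∷ _) ∷ _) → ¬Rxy Rxy }) (sublists xs))))
      (cong length (sym (List.filter-reject (R? x) ¬Rxy)))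
    -- With `x` and `y` both taken nothing more may be chosen, and exactly one sublist is empty.
    containing-y (yes Rxy) = trans
      (cong (_+ count (R? x) xs) (trans
        (count-≐ (Q? ∘ (y ∷_)) (λ ys → length ys ℕ.≟ 0)
          ((λ { {[]} _ → refl }) , (λ { {[]} _ → refl , (Rxy ∷ []) ∷ [] ∷ [] })) (sublists xs))
        (count-[] xs)))
      (cong length (sym (List.filter-accept (R? x) Rxy)))

  count-2-placements : ∀ xs → count (placement? 2) (sublists xs) ≡ pairs xs
  count-2-placements [] = refl
  count-2-placements (x ∷ xs) = begin
    count (placement? 2) (map (x ∷_) (sublists xs) ++ sublists xs)
      ≡⟨ count-++ (placement? 2) (map (x ∷_) (sublists xs)) _ ⟩
    count (placement? 2) (map (x ∷_) (sublists xs)) + count (placement? 2) (sublists xs)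
      ≡⟨ cong₂ _+_ (count-map (placement? 2) (x ∷_) (sublists xs)) (count-2-placements xs) ⟩
    count (placement? 2 ∘ (x ∷_)) (sublists xs) + pairs xs
      ≡⟨ cong (_+ pairs xs) (count-2-placements-∷ x xs) ⟩
    count (R? x) xs + pairs xs ∎

  pairs-none : ∀ {xs} → AllPairs (λ x y → U.∁ (R x) y) xs → pairs xs ≡ 0
  pairs-none [] = refl
  pairs-none (¬Rx ∷ ¬R) = cong₂ _+_ (count-none (R? _) ¬Rx) (pairs-none ¬R)

-- The hypothesis stands for `f x` = d - c. Keeping the subtracted term on the left avoids truncated
-- subtraction; the counts of cells below are stated in the same form.
sum-const-diff : ∀ {A : Set} (f : A → ℕ) {c d xs} → All (λ x → f x + c ≡ d) xs →
  sum (map f xs) + length xs * c ≡ length xs * d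
sum-const-diff f [] = refl
sum-const-diff f {c} {d} {x ∷ xs} (eq ∷ eqs) = begin
  (f x + sum (map f xs)) + (c + length xs * c)
    ≡⟨ interchange (f x) (sum (map f xs)) c (length xs * c) ⟩
  (f x + c) + (sum (map f xs) + length xs * c)
    ≡⟨ cong₂ _+_ eq (sum-const-diff f eqs) ⟩
  d + length xs * d ∎
  where
  interchange : ∀ p q r s → (p + q) + (r + s) ≡ (p + r) + (q + s)
  interchange = solve-∀

applyUpTo-+ : ∀ {A : Set} (f : ℕ → A) a b →
  applyUpTo f (a + b) ≡ applyUpTo f a ++ applyUpTo (f ∘ (a +_)) b
applyUpTo-+ f zero    b = refl
applyUpTo-+ f (suc a) b = cong (f 0 ∷_) (applyUpTo-+ (f ∘ suc) a b)

-- Rows of a column sorted by level.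

module _ (m : ℕ) .{{_ : NonZero m}} where

  /-unique : ∀ {s t} → t * m ℕ.≤ s → s ℕ.< suc t * m → s / m ≡ t
  /-unique {s} {t} lower upper = ℕ.≤-antisym
    (ℕ.≤-pred (ℕ.m<n*o⇒m/o<n upper))
    (subst (ℕ._≤ s / m) (ℕ.m*n/n≡m t m) (ℕ./-monoˡ-≤ m lower))

  -- The `h` rows split into those below level `t`, those of level `t` and those above. The bound on
  -- `h` makes the middle block complete, so exactly `m` rows fail `P`.
  count-otherLevels : ∀ {P : U.Pred ℕ 0ℓ} (P? : U.Decidable P) {t h} →
    P U.≐ (λ s → t ≢ s / m) → suc t * m ℕ.≤ h → count P? (upTo h) + m ≡ h
  count-otherLevels P? {t} {h} (P⊆ , ⊆P) full with e , refl ← ℕ.m≤n⇒∃[o]m+o≡n full = begin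
    count P? (upTo (suc t * m + e)) + m
      ≡⟨ cong (λ xs → count P? xs + m) split ⟩
    count P? ((upTo (t * m) ++ levelT) ++ above) + m
      ≡⟨ cong (_+ m) (trans (count-++ P? (upTo (t * m) ++ levelT) above)
           (cong (_+ count P? above) (count-++ P? (upTo (t * m)) levelT))) ⟩
    count P? (upTo (t * m)) + count P? levelT + count P? above + m
      ≡⟨ cong (_+ m) (cong₂ _+_ (cong₂ _+_
           (trans (count-all P? (All.applyUpTo⁺₁ id _ below∈P)) (List.length-upTo (t * m)))
           (count-none P? (All.applyUpTo⁺₁ (t * m +_) _ levelT∉P)))
           (trans (count-all P? (All.applyUpTo⁺₂ (suc t * m +_) e above∈P))
             (List.length-applyUpTo (suc t * m +_) e))) ⟩
    t * m + 0 + e + m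
      ≡⟨ rearrange (t * m) e m ⟩
    suc t * m + e ∎
    where
    levelT = applyUpTo (t * m +_) m
    above  = applyUpTo (suc t * m +_) e

    split : upTo (suc t * m + e) ≡ (upTo (t * m) ++ levelT) ++ above
    split = trans (applyUpTo-+ id (suc t * m) e)
      (cong (_++ above) (trans (cong upTo (ℕ.+-comm m (t * m))) (applyUpTo-+ id (t * m) m)))

    below∈P : ∀ {s} → s ℕ.< t * m → _
    below∈P s< = ⊆P (ℕ.<⇒≢ (ℕ.m<n*o⇒m/o<n s<) ∘ sym)

    levelT∉P : ∀ {d} → d ℕ.< m → _
    levelT∉P {d} d<m p = P⊆ p (sym (/-unique (ℕ.m≤m+n (t * m) d)
      (subst (t * m + d ℕ.<_) (ℕ.+-comm (t * m) m) (ℕ.+-monoʳ-< (t * m) d<m))))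

    above∈P : ∀ d → _
    above∈P d = ⊆P (λ t≡ → ℕ.<-irrefl t≡ (subst (ℕ._≤ (suc t * m + d) / m)
      (ℕ.m*n/n≡m (suc t) m) (ℕ./-monoˡ-≤ m (ℕ.m≤m+n (suc t * m) d))))

    rearrange : ∀ x y z → x + 0 + y + z ≡ (z + x) + y
    rearrange = solve-∀

  -- The second rook number of a singleton board.

  module _ {n} (B : Board n) where

    column : Fin n → List (Cell n)
    column i = map (i ,_) (upTo (height B i))

    length-column : ∀ i → length (column i) ≡ height B i
    length-column i = trans (List.length-map (i ,_) (upTo (height B i))) (List.length-upTo (height B i))

    -- A level that column i only starts is still complete in every later
    -- column, by the singleton condition.
    level-full : Singleton m B → ∀ {i j r} → i < j → r ℕ.< height B i →
      suc (r / m) * m ℕ.≤ height B j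
    level-full single {i} {j} {r} i<j r<b with r / m ℕ.<? height B i / m
    -- The level of `r` lies below that of `height B i`, so column `i` itself fills it and later
    -- columns are at least as high.
    ... | yes lower = ℕ.≤-trans (ℕ.*-monoˡ-≤ m lower)
      (ℕ.≤-trans (ℕ.m/n*n≤m (height B i) m) (increasing B (ℕ.<⇒≤ i<j)))
    ... | no ¬lower = ℕ.≤-trans (ℕ.*-monoˡ-≤ m next<)
      (ℕ.≤-trans (ℕ.m/n*n≤m (height B i⁺) m) (increasing B i⁺≤j))
      where
      top : r / m ≡ height B i / m
      top = ℕ.≤-antisym (ℕ./-monoˡ-≤ m (ℕ.<⇒≤ r<b)) (ℕ.≮⇒≥ ¬lower)

      1+i<n : suc (toℕ i) ℕ.< n
      1+i<n = ℕ.≤-<-trans i<j (Fin.toℕ<n j)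

      i⁺ : Fin n
      i⁺ = fromℕ< 1+i<n

      i⁺≤j : i⁺ Fin.≤ j
      i⁺≤j = subst (ℕ._≤ toℕ j) (sym (Fin.toℕ-fromℕ< 1+i<n)) i<j

      -- If `height B i` were a multiple of `m`, it would be the lowest row of the level of `r` and
      -- hence at most `r`.
      partial : height B i ∸ ⌊_⌋ m (height B i) ≢ 0
      partial eq = ℕ.<-irrefl refl (ℕ.<-≤-trans r<b (ℕ.≤-trans (ℕ.m∸n≡0⇒m≤n eq)
        (subst (λ q → q * m ℕ.≤ r) top (ℕ.m/n*n≤m r m))))

      next< : r / m ℕ.< height B i⁺ / m
      next< = subst (ℕ._< height B i⁺ / m) (sym top)
        (ℕ.*-cancelʳ-< m _ _ (single i i⁺ (Fin.toℕ-fromℕ< 1+i<n) partial))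

    pairs-column : ∀ i → pairs (nonAttacking? m) (column i) ≡ 0
    pairs-column i = pairs-none (nonAttacking? m) (sameColumn (upTo (height B i)))
      where
      sameColumn : ∀ rs → AllPairs (λ c d → U.∁ (NonAttacking m c) d) (map (i ,_) rs)
      sameColumn []       = []
      sameColumn (r ∷ rs) = All.map⁺ (All.universal (λ _ (_ , i≢i) → i≢i refl) rs) ∷ sameColumn rs

    module _ (single : Singleton m B) where

      count-column : ∀ {i j r} → i < j → r ℕ.< height B i →
        count (nonAttacking? m (i , r)) (column j) + m ≡ height B j
      count-column {i} {j} {r} i<j r<b = trans
        (cong (_+ m) (count-map (nonAttacking? m (i , r)) (j ,_) (upTo (height B j))))
        (count-otherLevels (nonAttacking? m (i , r) ∘ (j ,_))
          -- The columns are distinct, so `NonAttacking` amounts to inequality of levels.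
          (proj₁ , (_, Fin.<⇒≢ i<j)) (level-full single i<j r<b))

      -- Enumerating the columns by an arbitrary `f` lets the induction drop the first one by
      -- passing to `f ∘ suc`.
      count-columns : ∀ {i r} → r ℕ.< height B i → ∀ k (f : Fin k → Fin n) → (∀ a → i < f a) →
        count (nonAttacking? m (i , r)) (concatMap column (tabulate f)) + k * m ≡ ∑ (height B ∘ f)
      count-columns r<b zero f i<f = refl
      count-columns {i} {r} r<b (suc k) f i<f = begin
        count R? (column (f zero) ++ rest) + (m + k * m)
          ≡⟨ cong (_+ (m + k * m)) (count-++ R? (column (f zero)) rest) ⟩
        count R? (column (f zero)) + count R? rest + (m + k * m)
          ≡⟨ interchange (count R? (column (f zero))) (count R? rest) m (k * m) ⟩
        (count R? (column (f zero)) + m) + (count R? rest + k * m)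
          ≡⟨ cong₂ _+_ (count-column (i<f zero) r<b) (count-columns r<b k (f ∘ suc) (i<f ∘ suc)) ⟩
        ∑ (height B ∘ f) ∎
        where
        R?   = nonAttacking? m (i , r)
        rest = concatMap column (tabulate (f ∘ suc))
        interchange : ∀ p q s t → p + q + (s + t) ≡ (p + s) + (q + t)
        interchange = solve-∀

      crossPairs-columns : ∀ i k (f : Fin k → Fin n) → (∀ a → i < f a) →
        crossPairs (nonAttacking? m) (column i) (concatMap column (tabulate f))
          + height B i * (k * m) ≡ height B i * ∑ (height B ∘ f)
      crossPairs-columns i k f i<f = subst
        (λ l → crossPairs (nonAttacking? m) (column i) rest + l * (k * m) ≡ l * ∑ (height B ∘ f))
        (length-column i)
        (sum-const-diff (λ c → count (nonAttacking? m c) rest)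
          (All.map⁺ (All.applyUpTo⁺₁ id _ (λ r<b → count-columns r<b k f i<f))))
        where rest = concatMap column (tabulate f)

      -- Moving the subtracted terms to the left, this is
      -- 2 Σ_{a<b} h_a (h_b - m) = (Σ h)² - Σ h² - 2m Σ_a h_a (k - 1 - a).
      pairs-columns : ∀ k (f : Fin k → Fin n) → (∀ {a b} → a < b → f a < f b) →
        2 * pairs (nonAttacking? m) (concatMap column (tabulate f))
          + ∑ (λ a → height B (f a) * (height B (f a) + 2 * (m * (k ∸ suc (toℕ a)))))
          ≡ ∑ (height B ∘ f) * ∑ (height B ∘ f)
      pairs-columns zero f mono = refl
      pairs-columns (suc k) f mono = begin
        -- At the head `suc k ∸ suc 0` reduces to `k`, and the tail of the sum reduces to the same
        -- expression for `f ∘ suc`.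
        2 * pairs R? (column (f zero) ++ rest) + (h * (h + 2 * (m * k)) + T)
          ≡⟨ cong (λ p → 2 * p + (h * (h + 2 * (m * k)) + T))
               (trans (pairs-++ R? (column (f zero)) rest)
                 (cong (λ p → p + C + pairs R? rest) (pairs-column (f zero)))) ⟩
        2 * (C + pairs R? rest) + (h * (h + 2 * (m * k)) + T)
          -- The term in `m * k` is what completes `C` to `h * S`, the cross term of the square of
          -- `h + S`.
          ≡⟨ collect C (pairs R? rest) h m k T ⟩
        2 * (C + h * (k * m)) + h * h + (2 * pairs R? rest + T)
          ≡⟨ cong₂ (λ x y → 2 * x + h * h + y)
               (crossPairs-columns (f zero) k (f ∘ suc) (λ a → mono (s≤s ℕ.z≤n)))
               (pairs-columns k (f ∘ suc) (mono ∘ s≤s)) ⟩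
        2 * (h * S) + h * h + S * S
          ≡⟨ square h S ⟩
        (h + S) * (h + S) ∎
        where
        R?   = nonAttacking? m
        rest = concatMap column (tabulate (f ∘ suc))
        h    = height B (f zero)
        C    = crossPairs R? (column (f zero)) rest
        S    = ∑ (height B ∘ f ∘ suc)
        T    = ∑ (λ a → height B (f (suc a)) * (height B (f (suc a)) + 2 * (m * (k ∸ suc (toℕ a)))))
        collect : ∀ C p h m k T → 2 * (C + p) + (h * (h + 2 * (m * k)) + T)
          ≡ 2 * (C + h * (k * m)) + h * h + (2 * p + T)
        collect = solve-∀
        square : ∀ h S → 2 * (h * S) + h * h + S * S ≡ (h + S) * (h + S)
        square = solve-∀

    -- `n ∸ suc (toℕ i)` is the number of columns to the right of `i`. In each of them a cell of
    -- column `i` attacks `m` cells, and the factor 2 comes from doubling the rook number.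
    weight : Vector ℕ n
    weight i = height B i * (height B i + 2 * (m * (n ∸ suc (toℕ i))))

    rookNumber-2 : Singleton m B →
      2 * rookNumber m 2 B + ∑ weight ≡ ∑ (height B) * ∑ (height B)
    rookNumber-2 single = trans
      (cong (λ r → 2 * r + ∑ weight) (count-2-placements (nonAttacking? m) (cells B)))
      -- `allFin n` is `tabulate id`, so the board itself is the case where `f` is `id`.
      (pairs-columns single n id id)

-- Sums of vectors that differ in one or two places.

∑-differ-at : ∀ {n} (f g : Vector ℕ n) i → (∀ l → l ≢ i → f l ≡ g l) →
  ∑ f + g i ≡ ∑ g + f i
∑-differ-at {suc n} f g i agree = begin
  ∑ f + g i
    ≡⟨ cong (_+ g i) (Σ.sum-remove {i = i} f) ⟩
  f i + ∑ (removeAt f i) + g i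
    ≡⟨ cong (λ s → f i + s + g i)
         (Σ.sum-cong-≗ (λ l → agree (Fin.punchIn i l) (Fin.punchInᵢ≢i i l))) ⟩
  f i + ∑ (removeAt g i) + g i
    ≡⟨ swap (f i) (∑ (removeAt g i)) (g i) ⟩
  g i + ∑ (removeAt g i) + f i
    ≡⟨ cong (_+ f i) (Σ.sum-remove {i = i} g) ⟨
  ∑ g + f i ∎
  where
  swap : ∀ x y z → x + y + z ≡ z + y + x
  swap = solve-∀

-- The passage from `f` to `g` goes through `h`, which is `f` with its entry at `i` replaced by that
-- of `g`. Each half changes a single entry.
∑-differ-at₂ : ∀ {n} (f g : Vector ℕ n) {i j} → i ≢ j →
  (∀ l → l ≢ i → l ≢ j → f l ≡ g l) → ∑ f + (g i + g j) ≡ ∑ g + (f i + f j)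
∑-differ-at₂ f g {i} {j} i≢j agree = begin
  ∑ f + (g i + g j)      ≡⟨ ℕ.+-assoc (∑ f) (g i) (g j) ⟨
  ∑ f + g i + g j        ≡⟨ cong (_+ g j) f→h ⟩
  ∑ h + f i + g j        ≡⟨ swap (∑ h) (f i) (g j) ⟩
  ∑ h + g j + f i        ≡⟨ cong (_+ f i) h→g ⟩
  ∑ g + f j + f i        ≡⟨ rearrange (∑ g) (f j) (f i) ⟩
  ∑ g + (f i + f j)      ∎
  where
  h : Vector ℕ _
  h = updateAt f i (const (g i))

  hᵢ : h i ≡ g i
  hᵢ = updateAt-updates i f

  hₗ : ∀ l → l ≢ i → h l ≡ f l
  hₗ l l≢i = updateAt-minimal l i f l≢i

  f→h : ∑ f + g i ≡ ∑ h + f i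
  f→h = subst (λ x → ∑ f + x ≡ ∑ h + f i) hᵢ
    (∑-differ-at f h i (λ l l≢i → sym (hₗ l l≢i)))

  h-agree : ∀ l → l ≢ j → h l ≡ g l
  h-agree l l≢j with l Fin.≟ i
  ... | yes refl = hᵢ
  ... | no l≢i   = trans (hₗ l l≢i) (agree l l≢i l≢j)

  h→g : ∑ h + g j ≡ ∑ g + f j
  h→g = subst (λ x → ∑ h + g j ≡ ∑ g + x) (hₗ j (≢-sym i≢j)) (∑-differ-at h g j h-agree)

  swap : ∀ x y z → x + y + z ≡ x + z + y
  swap = solve-∀
  rearrange : ∀ x y z → x + y + z ≡ x + (z + y)
  rearrange = solve-∀

equal-sums : ∀ {x y u v} → x ≡ y → x + u ≡ y + v → u ≡ v
equal-sums {x} refl = ℕ.+-cancelˡ-≡ x _ _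

+a-+b≡+c-+d : ∀ a b c d → a + d ≡ c + b → ℤ.+ a ℤ.- ℤ.+ b ≡ ℤ.+ c ℤ.- ℤ.+ d
+a-+b≡+c-+d a b c d eq = begin
  ℤ.+ a ℤ.- ℤ.+ b         ≡⟨ ℤ.m-n≡m⊖n a b ⟩
  a ℤ.⊖ b                 ≡⟨ ℤ.+-cancelˡ-⊖ d a b ⟨
  (d + a) ℤ.⊖ (d + b)     ≡⟨ cong₂ ℤ._⊖_ (trans (ℕ.+-comm d a) (trans eq (ℕ.+-comm c b))) (ℕ.+-comm d b) ⟩
  (b + c) ℤ.⊖ (b + d)     ≡⟨ ℤ.+-cancelˡ-⊖ b c d ⟩
  c ℤ.⊖ d                 ≡⟨ ℤ.m-n≡m⊖n c d ⟨
  ℤ.+ c ℤ.- ℤ.+ d         ∎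

-- Comparison of the two ends of an edge.

module Edge (m : ℕ) .{{_ : NonZero m}} {n} (B₁ B₂ : Board n)
  (single₁ : Singleton m B₁) (single₂ : Singleton m B₂)
  (r₂-equal : rookNumber m 2 B₁ ≡ rookNumber m 2 B₂)
  {i j k} (k>0 : k ℕ.> 0) (i≢j : i ≢ j)
  (diffᵢ : height B₁ i ≡ height B₂ i + k) (diffⱼ : height B₂ j ≡ height B₁ j + k)
  (agree : ∀ l → l ≢ i → l ≢ j → height B₁ l ≡ height B₂ l)
  where

  private
    p = height B₂ i
    q = height B₁ j
    wᵢ = n ∸ suc (toℕ i)
    wⱼ = n ∸ suc (toℕ j)
    z₁ = rootVector m B₁
    z₂ = rootVector m B₂

  ∑-height-equal : ∑ (height B₁) ≡ ∑ (height B₂)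
  ∑-height-equal = ℕ.+-cancelʳ-≡ (p + height B₂ j) _ _
    (trans (∑-differ-at₂ (height B₁) (height B₂) i≢j agree)
      (cong (∑ (height B₂) +_) (begin
        height B₁ i + q    ≡⟨ cong (_+ q) diffᵢ ⟩
        p + k + q          ≡⟨ rearrange p k q ⟩
        p + (q + k)        ≡⟨ cong (p +_) diffⱼ ⟨
        p + height B₂ j    ∎)))
    where
    rearrange : ∀ x y z → x + y + z ≡ x + (z + y)
    rearrange = solve-∀

  ∑-weight-equal : ∑ (weight m B₁) ≡ ∑ (weight m B₂)
  ∑-weight-equal = equal-sums (cong (2 *_) r₂-equal) (begin
    2 * rookNumber m 2 B₁ + ∑ (weight m B₁) ≡⟨ rookNumber-2 m B₁ single₁ ⟩
    ∑ (height B₁) * ∑ (height B₁)           ≡⟨ cong (λ s → s * s) ∑-height-equal ⟩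
    ∑ (height B₂) * ∑ (height B₂)           ≡⟨ rookNumber-2 m B₂ single₂ ⟨
    2 * rookNumber m 2 B₂ + ∑ (weight m B₂) ∎)

  balanced-weights : p + m * wᵢ ≡ q + m * wⱼ
  balanced-weights = ℕ.*-cancelˡ-≡ _ _ (2 * k) {{ℕ.m*n≢0 2 k {{_}} {{ℕ.>-nonZero k>0}}}}
    -- Both sides of `raw` contain the two smaller weights and `k * k`. Cancelling these leaves
    -- multiples of `2 * k`, which is nonzero because `k>0`.
    (ℕ.+-cancelˡ-≡ _ _ _ (trans (expandᵢ p q k m wᵢ wⱼ) (trans raw (sym (expandⱼ p q k m wᵢ wⱼ)))))
    where
    weights-agree : ∀ l → l ≢ i → l ≢ j → weight m B₁ l ≡ weight m B₂ l
    weights-agree l l≢i l≢j = cong (λ h → h * (h + 2 * (m * (n ∸ suc (toℕ l))))) (agree l l≢i l≢j)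

    raw : (p + k) * ((p + k) + 2 * (m * wᵢ)) + q * (q + 2 * (m * wⱼ))
        ≡ p * (p + 2 * (m * wᵢ)) + (q + k) * ((q + k) + 2 * (m * wⱼ))
    raw = subst₂
      (λ hᵢ hⱼ → hᵢ * (hᵢ + 2 * (m * wᵢ)) + q * (q + 2 * (m * wⱼ))
               ≡ p * (p + 2 * (m * wᵢ)) + hⱼ * (hⱼ + 2 * (m * wⱼ)))
      diffᵢ diffⱼ (sym (equal-sums ∑-weight-equal
        (∑-differ-at₂ (weight m B₁) (weight m B₂) i≢j weights-agree)))

    expandᵢ : ∀ p q k m u v →
      (p * (p + 2 * (m * u)) + q * (q + 2 * (m * v)) + k * k) + 2 * k * (p + m * u)
      ≡ (p + k) * ((p + k) + 2 * (m * u)) + q * (q + 2 * (m * v))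
    expandᵢ = solve-∀
    expandⱼ : ∀ p q k m u v →
      (p * (p + 2 * (m * u)) + q * (q + 2 * (m * v)) + k * k) + 2 * k * (q + m * v)
      ≡ p * (p + 2 * (m * u)) + (q + k) * ((q + k) + 2 * (m * v))
    expandⱼ = solve-∀

  -- This trades the distance to the right end for the column index. In integers it reads mi - p =
  -- mj - q, an equality of root entries.
  balanced-heights : p + m * toℕ j ≡ q + m * toℕ i
  -- The added summand completes `m * toℕ j` on the left and `m * toℕ i` on the right to `m * n`.
  balanced-heights = ℕ.+-cancelʳ-≡ (m * wᵢ + m * wⱼ + m) _ _ (begin
    p + m * toℕ j + (m * wᵢ + m * wⱼ + m)
      ≡⟨ collect p m (toℕ j) wᵢ wⱼ ⟩
    (p + m * wᵢ) + m * (wⱼ + suc (toℕ j))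
      ≡⟨ cong₂ _+_ balanced-weights (cong (m *_) (trans (complement j) (sym (complement i)))) ⟩
    (q + m * wⱼ) + m * (wᵢ + suc (toℕ i))
      ≡⟨ collect q m (toℕ i) wⱼ wᵢ ⟨
    q + m * toℕ i + (m * wⱼ + m * wᵢ + m)
      ≡⟨ cong (λ s → q + m * toℕ i + (s + m)) (ℕ.+-comm (m * wⱼ) (m * wᵢ)) ⟩
    q + m * toℕ i + (m * wᵢ + m * wⱼ + m) ∎)
    where
    complement : ∀ l → n ∸ suc (toℕ l) + suc (toℕ l) ≡ n
    complement l = ℕ.m∸n+n≡m (Fin.toℕ<n l)
    collect : ∀ p m j u v → p + m * j + (m * u + m * v + m) ≡ (p + m * u) + m * (v + suc j)
    collect = solve-∀

  root-i : z₂ i ≡ z₁ j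
  root-i = +a-+b≡+c-+d (m * toℕ i) p (m * toℕ j) q
    (trans (ℕ.+-comm (m * toℕ i) q) (trans (sym balanced-heights) (ℕ.+-comm p (m * toℕ j))))

  -- The larger heights are `p + k` and `q + k`, so this is `balanced-heights` shifted by `k`.
  root-j : z₂ j ≡ z₁ i
  root-j = +a-+b≡+c-+d (m * toℕ j) (height B₂ j) (m * toℕ i) (height B₁ i) (begin
    m * toℕ j + height B₁ i   ≡⟨ cong (m * toℕ j +_) diffᵢ ⟩
    m * toℕ j + (p + k)       ≡⟨ rotate (m * toℕ j) p k ⟩
    p + m * toℕ j + k         ≡⟨ cong (_+ k) balanced-heights ⟩
    q + m * toℕ i + k         ≡⟨ rotate (m * toℕ i) q k ⟨
    m * toℕ i + (q + k)       ≡⟨ cong (m * toℕ i +_) diffⱼ ⟨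
    m * toℕ i + height B₂ j   ∎)
    where
    rotate : ∀ x y z → x + (y + z) ≡ y + x + z
    rotate = solve-∀

  -- By `root-i`, equality would give column `i` the same root entry in both boards, hence the same
  -- height, against `k>0`.
  root-i≢root-j : z₁ i ≢ z₁ j
  root-i≢root-j eq = ℕ.<-irrefl (sym k≡0) k>0
    where
    heights-equal : height B₁ i ≡ p
    heights-equal = ℤ.+-injective (ℤ.neg-injective
      (ℤ-group.∙-cancelˡ (ℤ.+ (m * toℕ i)) _ _ (trans eq (sym root-i))))
    k≡0 : k ≡ 0
    k≡0 = ℕ.+-cancelˡ-≡ p _ _ (trans (sym diffᵢ) (trans heights-equal (sym (ℕ.+-identityʳ p))))

  root-agree : ∀ l → l ≢ i → l ≢ j → z₂ l ≡ z₁ l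
  root-agree l l≢i l≢j = cong (λ h → ℤ.+ (m * toℕ l) ℤ.- ℤ.+ h) (sym (agree l l≢i l≢j))

theorem17 : ∀ (m : ℕ) .{{_ : NonZero m}} (n : ℕ) (B₁ B₂ : Board n) →
    Singleton m B₁ → Singleton m B₂ → RookEquivalent m B₁ B₂ →
    IsEdge m B₁ B₁ B₂ →
    ∃[ i₁ ] ∃[ i₂ ] i₁ < i₂
    × rootVector m B₁ i₁ ≢ rootVector m B₁ i₂
    × rootVector m B₂ i₁ ≡ rootVector m B₁ i₂
    × rootVector m B₂ i₂ ≡ rootVector m B₁ i₁
    × (∀ (i : Fin n) → i ≢ i₁ → i ≢ i₂ → rootVector m B₂ i ≡ rootVector m B₁ i)
theorem17 m n B₁ B₂ single₁ single₂ equiv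
  (_ , _ , i , j , k , k>0 , i≢j , diffᵢ , diffⱼ , agree)
  with Fin.<-cmp i j
     | Edge.root-i≢root-j m B₁ B₂ single₁ single₂ (equiv 2) k>0 i≢j diffᵢ diffⱼ agree
     | Edge.root-i m B₁ B₂ single₁ single₂ (equiv 2) k>0 i≢j diffᵢ diffⱼ agree
     | Edge.root-j m B₁ B₂ single₁ single₂ (equiv 2) k>0 i≢j diffᵢ diffⱼ agree
     | Edge.root-agree m B₁ B₂ single₁ single₂ (equiv 2) k>0 i≢j diffᵢ diffⱼ agree
... | tri< i<j _ _ | distinct | zᵢ | zⱼ | same = i , j , i<j , distinct , zᵢ , zⱼ , same
... | tri≈ _ i≡j _ | _        | _  | _  | _    = contradiction i≡j i≢j
-- An edge does not order its two columns, while the conclusion does; the roles of `i` and `j` are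
-- exchanged here.
... | tri> _ _ j<i | distinct | zᵢ | zⱼ | same =
  j , i , j<i , ≢-sym distinct , zⱼ , zᵢ , λ l l≢j l≢i → same l l≢i l≢j
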